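{- Let $H$ be a bull or a hammer, and let $\mathcal{C}$ be the class of $(C_4,H)$-free graphs. Let $k\ge 2$ be an integer, and let $\mathcal{F}$ be a hereditary class of graphs satisfying $\chi(F)\le k$ for every $F\in\mathcal{F}$ with $\omega(F)\le 2$. Then, for every $G\in\mathcal{C}\cap\mathcal{F}$, $\chi(G)\le\frac{k}{2}\omega(G)$ if $H$ is a bull, and $\chi(G)\le\omega(G)+k-2$ if $H$ is a hammer.
   Context: All graphs are finite and simple. $\omega(G)$ is the clique number and $\chi(G)$ the chromatic number of $G$. A class of graphs is hereditary if it is closed under taking induced subgraphs. For graphs $H_1,\dots,H_t$, a graph $G$ is $(H_1,\dots,H_t)$-free if no induced subgraph of $G$ is isomorphic to any $H_i$. $C_4$ is the cycle on 4 vertices. A bull is the 5-vertex graph consisting of a triangle with two disjoint pendant edges (i.e. pendant edges attached at two distinct vertices of the triangle). A hammer is the 5-vertex graph obtained by identifying an endvertex of a path on 3 vertices with a vertex of a triangle. -}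

module Defs where

open import Data.Fin.Base using (Fin; finToFun; funToFin)
open import Data.Fin.Patterns using (0F; 1F; 2F; 3F; 4F)
open import Data.Fin.Properties
  using (_≟_; any?; all?; finToFun-funToFin; injective⇒≤)
open import Data.List.Base using (List; []; _∷_)
import Data.List.Membership.DecPropositional as DecMembership
open import Data.List.Membership.Propositional using (_∈_)
open import Data.List.Relation.Unary.All using (All)
open import Data.Nat.Base using (ℕ; zero; suc; _≤_; z≤n; s≤s)
open import Data.Nat.Properties using (≤-pred; ≤∧≢⇒<)
open import Data.Product.Base using (_×_; _,_; ∃; proj₁; proj₂)
open import Data.Product.Properties using (≡-dec)
open import Data.Sum.Base using (_⊎_; swap)
open import Function.Base using (id; _∘_)
open import Function.Bundles using (_⇔_; _↔_; _↣_; Inverse; Injection)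
open import Level using (Level; 0ℓ) renaming (suc to lsuc; _⊔_ to _⊔ˡ_)
open import Relation.Binary.Core using (Rel)
open import Relation.Binary.Definitions as B using (Irreflexive; Symmetric)
open import Relation.Binary.PropositionalEquality
  using (_≡_; _≢_; refl; sym; subst; subst₂)
open import Relation.Nullary.Decidable
  using (yes; no; map′; ¬?; _×-dec_; _⊎-dec_; _→-dec_)
open import Relation.Nullary.Negation using (¬_; contradiction)
open import Relation.Unary using (Pred; Decidable)

record Graph : Set₁ where
  field
    order  : ℕ
  Vertex : Set
  Vertex = Fin order
  field
    _~_    : Rel Vertex 0ℓ
    _~?_   : B.Decidable _~_
    ~-sym  : Symmetric _~_
    ~-irr  : Irreflexive _≡_ _~_

open Graph using (order; Vertex)

record _≅_ (G H : Graph) : Set where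
  private
    module G = Graph G
    module H = Graph H
  field
    bijection : G.Vertex ↔ H.Vertex
    adjacency : ∀ u v → (u G.~ v) ⇔ (Inverse.to bijection u H.~ Inverse.to bijection v)

infix 4 _≅_

-- The subgraph of G induced on the image of f. Since the vertex set of a graph
-- is always some Fin m, an induced subgraph comes with a numbering of its
-- vertices; all numberings are obtained as f varies.
induced : (G : Graph) {m : ℕ} → Fin m ↣ Vertex G → Graph
induced G {m} f = record
  { order = m
  ; _~_   = λ u v → to u G.~ to v
  ; _~?_  = λ u v → to u G.~? to v
  ; ~-sym = G.~-sym
  ; ~-irr = λ { refl → G.~-irr refl }
  }
  where
  module G = Graph G
  open Injection f using (to)

Hereditary : {ℓ : Level} → Pred Graph ℓ → Set (lsuc 0ℓ ⊔ˡ ℓ)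
Hereditary 𝓕 = ∀ G {m} (f : Fin m ↣ Vertex G) → 𝓕 G → 𝓕 (induced G f)

Free : List Graph → Pred Graph (lsuc 0ℓ)
Free Hs G = All (λ H → ∀ {m} (f : Fin m ↣ Vertex G) → ¬ (induced G f ≅ H)) Hs

fromEdges : (n : ℕ) → List (Fin n × Fin n) → Graph
fromEdges n es = record
  { order = n
  ; _~_   = λ u v → u ≢ v × ((u , v) ∈ es ⊎ (v , u) ∈ es)
  ; _~?_  = λ u v → ¬? (u ≟ v) ×-dec ((u , v) ∈? es ⊎-dec (v , u) ∈? es)
  ; ~-sym = λ (u≢v , e) → u≢v ∘ sym , swap e
  ; ~-irr = λ u≡v (u≢v , _) → u≢v u≡v
  }
  where open DecMembership (≡-dec (_≟_ {n}) (_≟_ {n})) using (_∈?_)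

C₄ : Graph
C₄ = fromEdges 4 ((0F , 1F) ∷ (1F , 2F) ∷ (2F , 3F) ∷ (3F , 0F) ∷ [])

-- Triangle 0 1 2, with pendant edges at 0 and 1.
bull : Graph
bull = fromEdges 5
  ((0F , 1F) ∷ (1F , 2F) ∷ (2F , 0F) ∷ (0F , 3F) ∷ (1F , 4F) ∷ [])

-- Triangle 0 1 2, with the path 0 3 4 attached at its endvertex 0.
hammer : Graph
hammer = fromEdges 5
  ((0F , 1F) ∷ (1F , 2F) ∷ (2F , 0F) ∷ (0F , 3F) ∷ (3F , 4F) ∷ [])

module _ (G : Graph) where
  open Graph G using (_~_)

  IsColouring : (c : ℕ) → (Vertex G → Fin c) → Set
  IsColouring c φ = ∀ u v → u ~ v → φ u ≢ φ v

  Colourable : Pred ℕ 0ℓ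
  Colourable c = ∃ (IsColouring c)

  -- The entries of f are automatically distinct, as ~ is irreflexive.
  IsClique : (m : ℕ) → (Fin m → Vertex G) → Set
  IsClique m f = ∀ i j → i ≢ j → f i ~ f j

  HasClique : Pred ℕ 0ℓ
  HasClique m = ∃ (IsClique m)

IsLeast IsGreatest : Pred ℕ 0ℓ → Pred ℕ 0ℓ
IsLeast    P m = P m × (∀ j → P j → m ≤ j)
IsGreatest P m = P m × (∀ j → P j → j ≤ m)

least : {P : Pred ℕ 0ℓ} → Decidable P → ∀ n → P n → ∃ (IsLeast P)
least P? zero    p = zero , p , λ _ _ → z≤n
least P? (suc n) p with P? zero
... | yes p₀ = zero , p₀ , λ _ _ → z≤n
... | no ¬p₀ with least (P? ∘ suc) n p
...   | m , pm , min = suc m , pm , λ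
  { zero    p₀ → contradiction p₀ ¬p₀
  ; (suc j) pj → s≤s (min j pj)
  }

greatest : {P : Pred ℕ 0ℓ} → Decidable P → P 0 →
           ∀ b → (∀ j → P j → j ≤ b) → ∃ (IsGreatest P)
greatest P? p₀ zero    bound = zero , p₀ , bound
greatest {P} P? p₀ (suc b) bound with P? (suc b)
... | yes p = suc b , p , bound
... | no ¬p = greatest P? p₀ b λ j pj →
  ≤-pred (≤∧≢⇒< (bound j pj) λ eq → ¬p (subst P eq pj))

module _ (G : Graph) where
  open Graph G using (_~_; _~?_; ~-irr)

  colourable? : Decidable (Colourable G)
  colourable? c = map′
    (λ (i , p) → finToFun i , p)
    (λ (φ , p) → funToFin φ , λ u v u~v eq → p u v u~v
      (subst₂ _≡_ (finToFun-funToFin φ u) (finToFun-funToFin φ v) eq))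
    (any? λ i → all? λ u → all? λ v →
      (u ~? v) →-dec ¬? (finToFun {c} {order G} i u ≟ finToFun i v))

  hasClique? : Decidable (HasClique G)
  hasClique? m = map′
    (λ (i , p) → finToFun i , p)
    (λ (f , p) → funToFin f , λ i j i≢j →
      subst₂ _~_ (sym (finToFun-funToFin f i)) (sym (finToFun-funToFin f j)) (p i j i≢j))
    (any? λ k → all? λ i → all? λ j →
      ¬? (i ≟ j) →-dec (finToFun {order G} {m} k i ~? finToFun k j))

  clique-injective : ∀ {m} (f : Fin m → Vertex G) → IsClique G m f →
                     ∀ {i j} → f i ≡ f j → i ≡ j
  clique-injective f p {i} {j} eq with i ≟ j
  ... | yes i≡j = i≡j
  ... | no  i≢j = contradiction (p i j i≢j) (~-irr eq)

  chromaticNumber : ∃ (IsLeast (Colourable G))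
  chromaticNumber = least colourable? (order G) (id , λ u v u~v u≡v → ~-irr u≡v u~v)

  cliqueNumber : ∃ (IsGreatest (HasClique G))
  cliqueNumber = greatest hasClique? ((λ ()) , λ ()) (order G)
    λ m (f , p) → injective⇒≤ (clique-injective f p)

  χ : ℕ
  χ = proj₁ chromaticNumber

  ω : ℕ
  ω = proj₁ cliqueNumber

{-# OPTIONS --safe #-}

-- Colour the vertex sets X of G by induction, with f(ω(X)) colours, where f(m)
-- is ⌊km/2⌋ for the bull and m + k − 2 for the hammer. A vertex adjacent to all
-- others costs one colour and lowers ω by one; along a clique cutset (possibly
-- empty) colourings are glued after permuting colours. Suppose X has neither.
--
-- Hammer: X is triangle-free. If N[a] is maximal among closed neighbourhoods of
-- vertices in triangles, then following an edge xy with x ∈ N(a), y ∉ N[a], either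
-- x or a common neighbour of a and x has a larger closed neighbourhood.
--
-- Bull: N[u] ⊆ N[v] implies N[u] = N[v], as otherwise there is a clique cutset.
-- Every triangle has two vertices u, v with N[u] ⊆ N[v], as otherwise private
-- neighbours of its vertices yield a 3-sun, which contains a bull. So X is
-- obtained from a triangle-free graph by substituting cliques, and one vertex
-- from each clique of twins forms a k-colourable set whose deletion lowers ω by two.
module Submission where

open import Defs
open import Data.Bool.Base using (if_then_else_)
open import Data.Empty using (⊥; ⊥-elim)
open import Data.Fin.Base as Fin using (Fin; zero; suc; _↑ˡ_; _↑ʳ_; inject≤)
open import Data.Fin.Induction using (<-wellFounded)
open import Data.Fin.Patterns using (0F; 1F; 2F; 3F)
open import Data.Fin.Permutation.Components using (transpose; transpose-inverse)
open import Data.Fin.Properties as Fin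
  using (_≟_; any?; all?; inject≤-injective; ↑ˡ-injective; ↑ʳ-injective; splitAt-↑ˡ; splitAt-↑ʳ)
open import Data.Fin.Subset using (Subset; _⊂_; ⊤; ⁅_⁆) renaming (_∈_ to _∈ˢ_; _∉_ to _∉ˢ_)
open import Data.Fin.Subset.Induction using (⊂-wellFounded; ⊃-wellFounded)
open import Data.Fin.Subset.Properties using (_∈?_; anySubset?; ∈⊤; x∈⁅x⁆; x∈⁅y⁆⇒x≡y)
open import Data.List.Base using (List; []; _∷_; allFin; filter; length; lookup)
open import Data.List.Membership.Propositional using () renaming (_∈_ to _∈ᴸ_)
open import Data.List.Membership.Propositional.Properties
  using (∈-allFin; ∈-filter⁺; ∈-filter⁻; ∈-lookup)
open import Data.List.Relation.Unary.All as All using (_∷_; [])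
open import Data.List.Relation.Unary.Any as Any using (here; there)
open import Data.List.Relation.Unary.Any.Properties using (lookup-index)
open import Data.List.Relation.Unary.Unique.Propositional using (Unique; _∷_)
open import Data.List.Relation.Unary.Unique.Propositional.Properties using (allFin⁺; filter⁺)
open import Data.Nat.Base using (ℕ; zero; suc; _+_; _*_; _∸_; _≤_; z≤n; s≤s; ⌊_/2⌋)
open import Data.Nat.Properties
  using ( ≤-refl; ≤-reflexive; ≤-trans; n≤1+n; 1+n≰n; ≮⇒≥; m≤m+n; +-suc; +-monoˡ-≤; +-∸-assoc
        ; m+[n∸m]≡n; *-suc; *-monoʳ-≤; *-distribˡ-+; ⌊n/2⌋-mono)
open import Data.Product.Base using (∃; _×_; _,_; proj₁; proj₂)
open import Data.Sum.Base using (_⊎_; inj₁; inj₂; [_,_]′)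
open import Data.Unit.Base using (tt) renaming (⊤ to Unit)
open import Data.Vec.Base as Vec using (tabulate; _∷_; [])
open import Data.Vec.Functional using () renaming (_∷_ to _∷ᶠ_)
open import Data.Vec.Properties using (lookup⇒[]=; []=⇒lookup; lookup∘tabulate)
open import Function.Base using (_∘_; id; const)
open import Function.Bundles using (_↣_; _⇔_; Inverse; Injection; mk↣; mk⇔)
open import Function.Construct.Composition using (_⇔-∘_)
open import Function.Construct.Identity using (↔-id; ⇔-id)
open import Function.Construct.Symmetry using (⇔-sym)
open import Function.Properties.Inverse using (Inverse⇒Injection)
open import Induction.WellFounded using (Acc; acc)
open import Level using (Level; 0ℓ)
open import Relation.Binary.Definitions using (tri<; tri≈; tri>)
open import Relation.Binary.PropositionalEquality
  using (_≡_; _≢_; refl; sym; trans; cong; subst; subst₂)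
open import Relation.Nullary.Decidable
  using ( Dec; yes; no; does; dec-true; dec-false; decidable-stable
        ; ¬?; _×-dec_; _⊎-dec_; _→-dec_)
open import Relation.Nullary.Negation using (¬_; contradiction)
open import Relation.Unary using (Pred; Decidable; _∈_; _∩_)

-- Decidable vertex subsets, permutations of colours and finite tables.

module _ {n : ℕ} {P : Pred (Fin n) 0ℓ} (P? : Decidable P) where

  select : Subset n
  select = tabulate (does ∘ P?)

  ∈-select⁺ : ∀ {x} → P x → x ∈ˢ select
  ∈-select⁺ {x} p = lookup⇒[]= x select (trans (lookup∘tabulate _ x) (dec-true (P? x) p))

  ∈-select⁻ : ∀ {x} → x ∈ˢ select → P x
  ∈-select⁻ {x} x∈ with P? x | trans (sym (lookup∘tabulate (does ∘ P?) x)) ([]=⇒lookup x∈)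
  ... | yes p | _ = p

module _ {c : ℕ} (i j : Fin c) where

  transpose-left : transpose i j i ≡ j
  transpose-left rewrite dec-true (i ≟ i) refl = refl

  transpose-other : ∀ {k} → k ≢ i → k ≢ j → transpose i j k ≡ k
  transpose-other {k} k≢i k≢j rewrite dec-false (k ≟ i) k≢i | dec-false (k ≟ j) k≢j = refl

  transpose-injective : ∀ {k l} → transpose i j k ≡ transpose i j l → k ≡ l
  transpose-injective eq =
    trans (sym (transpose-inverse j i)) (trans (cong (transpose j i) eq) (transpose-inverse j i))

-- Two colourings that are injective on K differ there by a permutation of the
-- colours, obtained as a product of one transposition per vertex of K.
align : ∀ {n c} {K : Pred (Fin n) 0ℓ} → Decidable K → (φ ψ : Fin n → Fin c) →
        (∀ x y → K x → K y → x ≢ y → φ x ≢ φ y × ψ x ≢ ψ y) →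
        ∀ xs → ∃ λ (π : Fin c → Fin c) →
          (∀ {i j} → π i ≡ π j → i ≡ j) × (∀ x → x ∈ᴸ xs → K x → π (ψ x) ≡ φ x)
align K? φ ψ inj []       = id , id , λ _ ()
align K? φ ψ inj (x ∷ xs) with align K? φ ψ inj xs | K? x
... | π , π-inj , agree | no ¬kx = π , π-inj , λ
  { _ (here refl) ky → contradiction ky ¬kx
  ; y (there y∈)  ky → agree y y∈ ky
  }
... | π , π-inj , agree | yes kx =
  transpose (π (ψ x)) (φ x) ∘ π , π-inj ∘ transpose-injective _ _ , agree′
  where
  agree′ : ∀ y → y ∈ᴸ (x ∷ xs) → _ → transpose (π (ψ x)) (φ x) (π (ψ y)) ≡ φ y
  agree′ _ (here refl) _ = transpose-left (π (ψ x)) (φ x)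
  agree′ y (there y∈) ky with y ≟ x
  ... | yes refl = transpose-left (π (ψ x)) (φ x)
  ... | no y≢x = trans
    (transpose-other _ _ (proj₂ (inj y x ky kx y≢x) ∘ π-inj)
      (proj₁ (inj y x ky kx y≢x) ∘ trans (sym (agree y y∈ ky))))
    (agree y y∈ ky)

lookup-injective : ∀ {A : Set} {xs : List A} → Unique xs → ∀ i j → lookup xs i ≡ lookup xs j → i ≡ j
lookup-injective (_ ∷ _)  zero    zero    _  = refl
lookup-injective (x∉ ∷ _) zero    (suc j) eq = contradiction eq (All.lookup x∉ (∈-lookup j))
lookup-injective (x∉ ∷ _) (suc i) zero    eq = contradiction (sym eq) (All.lookup x∉ (∈-lookup i))
lookup-injective (_ ∷ u)  (suc i) (suc j) eq = cong suc (lookup-injective u i j eq)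

-- A table of the entries above the diagonal, to be filled in row by row for a concrete graph.
ForPairs : ∀ {n} → (Fin n → Fin n → Set) → Set
ForPairs {zero}  R = Unit
ForPairs {suc n} R = (∀ j → R zero (suc j)) × ForPairs (λ i j → R (suc i) (suc j))

for-pair : ∀ {n} {R : Fin n → Fin n → Set} → ForPairs R → ∀ {i j} → i Fin.< j → R i j
for-pair (r , _)  {zero}  {suc j} _         = r j
for-pair (_ , rs) {suc i} {suc j} (s≤s i<j) = for-pair rs i<j

-- Closed adjacency, cliques and triangles.

module _ (G : Graph) where
  open Graph G

  infix 4 _≂_ _≂?_

  -- Membership in a closed neighbourhood; the negation says distinct and nonadjacent at once.
  _≂_ : Vertex → Vertex → Set
  u ≂ v = u ≡ v ⊎ u ~ v

  _≂?_ : ∀ u v → Dec (u ≂ v)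
  u ≂? v = (u ≟ v) ⊎-dec (u ~? v)

  ≂-sym : ∀ {u v} → u ≂ v → v ≂ u
  ≂-sym (inj₁ eq)  = inj₁ (sym eq)
  ≂-sym (inj₂ u~v) = inj₂ (~-sym u~v)

  ≂⇒~ : ∀ {u v} → u ≢ v → u ≂ v → u ~ v
  ≂⇒~ u≢v (inj₁ eq)  = contradiction eq u≢v
  ≂⇒~ u≢v (inj₂ u~v) = u~v

  -- Equality of `u` and `v` would turn `v ~ w` into `u ≂ w`.
  strict : ∀ {u v w} → u ≂ v → ¬ u ≂ w → v ~ w → u ~ v
  strict u≂v u≄w v~w = ≂⇒~ (λ { refl → u≄w (inj₂ v~w) }) u≂v

  strict′ : ∀ {u v w} → u ≂ v → ¬ w ≂ v → w ~ u → u ~ v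
  strict′ u≂v w≄v w~u = ≂⇒~ (λ { refl → w≄v (inj₂ w~u) }) u≂v

  VertexSet : Set
  VertexSet = Subset order

  ProperOn : VertexSet → ∀ {c} → (Vertex → Fin c) → Set
  ProperOn X φ = ∀ u v → u ∈ˢ X → v ∈ˢ X → u ~ v → φ u ≢ φ v

  ColourableOn : VertexSet → ℕ → Set
  ColourableOn X c = ∃ λ (φ : Vertex → Fin c) → ProperOn X φ

  CliqueIn : VertexSet → ℕ → Set
  CliqueIn X m = ∃ λ (q : Fin m → Vertex) → IsClique G m q × (∀ i → q i ∈ˢ X)

  HasTriangle : VertexSet → Set
  HasTriangle X = ∃ λ u → ∃ λ v → ∃ λ w →
    (u ∈ˢ X × v ∈ˢ X × w ∈ˢ X) × (u ~ v × v ~ w × w ~ u)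

  hasTriangle? : Decidable HasTriangle
  hasTriangle? X = any? λ u → any? λ v → any? λ w →
    ((u ∈? X) ×-dec (v ∈? X) ×-dec (w ∈? X)) ×-dec ((u ~? v) ×-dec (v ~? w) ×-dec (w ~? u))

  add-to-clique : ∀ {X m v} ((q , _) : CliqueIn X m) → v ∈ˢ X → (∀ i → v ~ q i) →
                  CliqueIn X (suc m)
  add-to-clique {v = v} (q , clique , q∈X) v∈X v~q = (v ∷ᶠ q) ,
    (λ { zero    zero    0≢0 → contradiction refl 0≢0
       ; zero    (suc j) _   → v~q j
       ; (suc i) zero    _   → ~-sym (v~q i)
       ; (suc i) (suc j) i≢j → clique i j (i≢j ∘ cong suc)
       }) ,
    λ { zero → v∈X ; (suc i) → q∈X i }

  triangle⇒3-clique : ∀ {X} → HasTriangle X → CliqueIn X 3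
  triangle⇒3-clique (u , v , w , (u∈ , v∈ , w∈) , (u~v , v~w , w~u)) =
    add-to-clique (add-to-clique (add-to-clique ((λ ()) , (λ ()) , λ ()) w∈ λ ())
      v∈ λ { zero → v~w ; (suc ()) })
      u∈ λ { zero → u~v ; (suc zero) → ~-sym w~u ; (suc (suc ())) }

  -- Colourings of vertex sets

  weaken-colours : ∀ {X c d} → c ≤ d → ColourableOn X c → ColourableOn X d
  weaken-colours c≤d (φ , proper) = (λ u → inject≤ (φ u) c≤d) ,
    λ u v u∈ v∈ u~v eq → proper u v u∈ v∈ u~v (inject≤-injective c≤d c≤d _ _ eq)

  -- The palettes are disjoint: `A` gets the first `c` colours, the rest of `X` the last `d`.
  colour-union : ∀ {X A B c d} → (∀ {u} → u ∈ˢ X → u ∉ˢ A → u ∈ˢ B) →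
                 ColourableOn A c → ColourableOn B d → ColourableOn X (c + d)
  colour-union {X} {A} {B} {c} {d} X∖A⊆B (φ , φ-proper) (ψ , ψ-proper) = χ′ , proper
    where
    χ′ : Vertex → Fin (c + d)
    χ′ u with u ∈? A
    ... | yes _ = φ u ↑ˡ d
    ... | no  _ = c ↑ʳ ψ u

    ↑ˡ≢↑ʳ : ∀ {i : Fin c} {j : Fin d} → i ↑ˡ d ≢ c ↑ʳ j
    ↑ˡ≢↑ʳ {i} {j} eq
      with () ← trans (sym (splitAt-↑ˡ c i d)) (trans (cong (Fin.splitAt c) eq) (splitAt-↑ʳ c d j))

    proper : ProperOn X χ′
    proper u v u∈ v∈ u~v with u ∈? A | v ∈? A
    ... | yes u∈A | yes v∈A = φ-proper u v u∈A v∈A u~v ∘ ↑ˡ-injective d _ _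
    ... | yes _   | no  _   = ↑ˡ≢↑ʳ
    ... | no  _   | yes _   = ↑ˡ≢↑ʳ ∘ sym
    ... | no u∉A  | no v∉A  =
      ψ-proper u v (X∖A⊆B u∈ u∉A) (X∖A⊆B v∈ v∉A) u~v ∘ ↑ʳ-injective c _ _

  infixl 6 _∖_

  diff? : ∀ X D → Decidable (λ (x : Vertex) → x ∈ˢ X × x ∉ˢ D)
  diff? X D x = (x ∈? X) ×-dec ¬? (x ∈? D)

  _∖_ : VertexSet → VertexSet → VertexSet
  X ∖ D = select (diff? X D)

  ∈-∖⁺ : ∀ {X D x} → x ∈ˢ X → x ∉ˢ D → x ∈ˢ X ∖ D
  ∈-∖⁺ {X} {D} x∈ x∉ = ∈-select⁺ (diff? X D) (x∈ , x∉)

  ∈-∖⁻ : ∀ {X D x} → x ∈ˢ X ∖ D → x ∈ˢ X × x ∉ˢ D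
  ∈-∖⁻ {X} {D} = ∈-select⁻ (diff? X D)

  -- Universal vertices and clique cutsets.

  Universal : VertexSet → Set
  Universal X = ∃ λ a → a ∈ˢ X × (∀ x → x ∈ˢ X → x ≂ a)

  Touches : VertexSet → Vertex → Set
  Touches D x = ∃ λ d → d ∈ˢ D × d ~ x

  touches? : ∀ D x → Dec (Touches D x)
  touches? D x = any? λ d → (d ∈? D) ×-dec (d ~? x)

  -- D is a union of components of X minus the clique formed by the
  -- neighbours of D, and e lies in another component.
  Separation : VertexSet → VertexSet → Set
  Separation X D =
    (∀ x → x ∈ˢ D → x ∈ˢ X) ×
    (∃ λ d → d ∈ˢ D) ×
    (∃ λ e → e ∈ˢ X × e ∉ˢ D × ¬ Touches D e) ×
    (∀ x y → x ∈ˢ X ∖ D → Touches D x → y ∈ˢ X ∖ D → Touches D y → x ≂ y)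

  Reducible : VertexSet → Set
  Reducible X = Universal X ⊎ ∃ (Separation X)

  reducible? : Decidable Reducible
  reducible? X =
    (any? λ a → (a ∈? X) ×-dec all? λ x → (x ∈? X) →-dec (x ≂? a))
    ⊎-dec
    anySubset? λ D →
      (all? λ x → (x ∈? D) →-dec (x ∈? X)) ×-dec
      (any? λ d → d ∈? D) ×-dec
      (any? λ e → (e ∈? X) ×-dec ¬? (e ∈? D) ×-dec ¬? (touches? D e)) ×-dec
      (all? λ x → all? λ y → (x ∈? (X ∖ D)) →-dec (touches? D x →-dec
        ((y ∈? (X ∖ D)) →-dec (touches? D y →-dec (x ≂? y)))))

  -- `Y` contains `D` and its neighbours in `X`. Both colourings are injective on the cutset `K`, so
  -- permuting the colours of `ψ` makes them agree there, and every edge of `X` leaving `D` ends in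
  -- `K`.
  glue : ∀ {X D Y c} → Separation X D →
         (∀ {x} → x ∈ˢ X → x ∈ˢ D ⊎ Touches D x → x ∈ˢ Y) →
         ColourableOn (X ∖ D) c → ColourableOn Y c → ColourableOn X c
  glue {X} {D} {Y} {c} (D⊆X , _ , _ , clique) D∪N⊆Y (φ , φ-proper) (ψ , ψ-proper) = χ′ , proper
    where
    K : Vertex → Set
    K x = x ∈ˢ X ∖ D × Touches D x

    aligned = align {K = K} (λ x → (x ∈? (X ∖ D)) ×-dec touches? D x) φ ψ
      (λ { x y (x∈ , tx) (y∈ , ty) x≢y →
         let x~y = ≂⇒~ x≢y (clique x y x∈ tx y∈ ty) in
         φ-proper x y x∈ y∈ x~y ,
         ψ-proper x y (D∪N⊆Y (proj₁ (∈-∖⁻ x∈)) (inj₂ tx)) (D∪N⊆Y (proj₁ (∈-∖⁻ y∈)) (inj₂ ty)) x~y })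
      (allFin order)
    π       = proj₁ aligned
    π-inj   = proj₁ (proj₂ aligned)
    π∘ψ≡φ   = λ x → proj₂ (proj₂ aligned) x (∈-allFin x)

    χ′ : Vertex → Fin c
    χ′ x with x ∈? D
    ... | yes _ = π (ψ x)
    ... | no  _ = φ x

    across : ∀ {u v} → u ∈ˢ D → v ∈ˢ X → v ∉ˢ D → u ~ v → π (ψ u) ≢ φ v
    across {u} {v} u∈D v∈ v∉D u~v eq =
      ψ-proper u v (D∪N⊆Y (D⊆X u u∈D) (inj₁ u∈D)) (D∪N⊆Y v∈ (inj₂ (u , u∈D , u~v))) u~v
        (π-inj (trans eq (sym (π∘ψ≡φ v (∈-∖⁺ v∈ v∉D , u , u∈D , u~v)))))

    proper : ProperOn X χ′
    proper u v u∈ v∈ u~v with u ∈? D | v ∈? D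
    ... | yes u∈D | yes v∈D = ψ-proper u v (D∪N⊆Y u∈ (inj₁ u∈D)) (D∪N⊆Y v∈ (inj₁ v∈D)) u~v ∘ π-inj
    ... | yes u∈D | no v∉D  = across u∈D v∈ v∉D u~v
    ... | no u∉D  | yes v∈D = across v∈D u∈ u∉D (~-sym u~v) ∘ sym
    ... | no u∉D  | no v∉D  = φ-proper u v (∈-∖⁺ u∈ u∉D) (∈-∖⁺ v∈ v∉D) u~v

  -- Deleting F lowers the clique number by two, provided it is at least three.
  DoubleTransversal : VertexSet → VertexSet → Set
  DoubleTransversal X F = ¬ HasTriangle F ×
    (∀ {m} ((q , _) : CliqueIn (X ∖ F) (suc m)) → ∃ λ p → ∃ λ r →
      p ∈ˢ X × r ∈ˢ X × p ~ r × (∀ i → p ~ q i) × (∀ i → r ~ q i))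

  -- Induction on the clique number and the vertex set.

  module _
    (f : ℕ → ℕ) (1≤f1 : 1 ≤ f 1) (f-suc : ∀ m → suc (f m) ≤ f (suc m))
    (k : ℕ) (k≤f2 : k ≤ f 2)
    (colour-triangle-free : ∀ X → ¬ HasTriangle X → ColourableOn X k)
    (decompose : ∀ X → HasTriangle X →
      Reducible X ⊎ (∃ (DoubleTransversal X) × (∀ m → k + f m ≤ f (2 + m))))
    where

    private
      f-mono : ∀ m → f 2 ≤ f (2 + m)
      f-mono zero    = ≤-refl
      f-mono (suc m) = ≤-trans (f-mono m) (≤-trans (n≤1+n _) (f-suc (2 + m)))

      restrict : ∀ {X Y m} → (∀ {x} → x ∈ˢ Y → x ∈ˢ X) → ¬ CliqueIn X m → ¬ CliqueIn Y m
      restrict Y⊆X ¬q (q , clique , q∈) = ¬q (q , clique , Y⊆X ∘ q∈)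

      triangle-free-case : ∀ m X → ¬ HasTriangle X → ColourableOn X (f (2 + m))
      triangle-free-case m X ¬t =
        weaken-colours (≤-trans k≤f2 (f-mono m)) (colour-triangle-free X ¬t)

      reduce : ∀ m X → ¬ CliqueIn X (4 + m) →
        (∀ Y → Y ⊂ X → ¬ CliqueIn Y (4 + m) → ColourableOn Y (f (3 + m))) →
        (∀ Y → ¬ CliqueIn Y (3 + m) → ColourableOn Y (f (2 + m))) →
        (∀ Y → ¬ CliqueIn Y (2 + m) → ColourableOn Y (f (1 + m))) →
        ColourableOn X (f (3 + m))
      reduce m X ¬q smaller one-less two-less with hasTriangle? X
      ... | no ¬t = triangle-free-case (suc m) X ¬t
      ... | yes t with decompose X t
      -- A fresh colour goes to `a`, which extends every clique of the rest.
      ...   | inj₁ (inj₁ (a , a∈X , a-univ)) =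
        weaken-colours (f-suc (2 + m))
          (colour-union {A = ⁅ a ⁆} ∈-∖⁺
            ((λ _ → zero) , λ u v u∈ v∈ u~v _ →
              ~-irr (trans (x∈⁅y⁆⇒x≡y a u∈) (sym (x∈⁅y⁆⇒x≡y a v∈))) u~v)
            (one-less (X ∖ ⁅ a ⁆) λ (q , clique , q∈) →
              ¬q (add-to-clique (q , clique , proj₁ ∘ ∈-∖⁻ ∘ q∈) a∈X
                λ i → ~-sym (≂⇒~ (λ eq → proj₂ (∈-∖⁻ (q∈ i)) (subst (_∈ˢ ⁅ a ⁆) (sym eq) (x∈⁅x⁆ a)))
                  (a-univ (q i) (proj₁ (∈-∖⁻ (q∈ i))))))))
      ...   | inj₁ (inj₂ (D , sep@(D⊆X , (d , d∈D) , (e , e∈X , e∉D , ¬te) , _))) =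
        glue sep (λ x∈ h → ∈-select⁺ Y? (x∈ , h))
          -- Both pieces are strictly smaller than `X`: the first misses `d`, the second `e`.
          (smaller (X ∖ D) ((λ x∈ → proj₁ (∈-∖⁻ x∈)) , d , D⊆X d d∈D , λ d∈ → proj₂ (∈-∖⁻ {X} d∈) d∈D)
            (restrict (λ x∈ → proj₁ (∈-∖⁻ x∈)) ¬q))
          (smaller (select Y?) ((λ x∈ → proj₁ (∈-select⁻ Y? x∈)) , e , e∈X ,
              λ e∈ → [ e∉D , ¬te ]′ (proj₂ (∈-select⁻ Y? e∈)))
            (restrict (λ x∈ → proj₁ (∈-select⁻ Y? x∈)) ¬q))
        where
        Y? : Decidable (λ x → x ∈ˢ X × (x ∈ˢ D ⊎ Touches D x))
        Y? x = (x ∈? X) ×-dec ((x ∈? D) ⊎-dec touches? D x)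
      -- `F` takes `k` colours. A clique of the rest would grow by `p` and `r`, so the clique bound
      -- there drops by two.
      ...   | inj₂ ((F , ¬tF , extends) , k+f≤f) =
        weaken-colours (k+f≤f (suc m))
          (colour-union {A = F} ∈-∖⁺ (colour-triangle-free F ¬tF)
            (two-less (X ∖ F) λ Q@(q , clique , q∈) →
              let p , r , p∈ , r∈ , p~r , p~q , r~q = extends Q in
              ¬q (add-to-clique (add-to-clique (q , clique , proj₁ ∘ ∈-∖⁻ ∘ q∈) r∈ r~q)
                   p∈ λ { zero → p~r ; (suc i) → p~q i })))

      -- Lexicographic recursion: the clique bound `1 + m` first, then `X` under strict inclusion.
      -- Bounds one and two are base cases, so that the step may lower the bound by two.
      colour-acc : ∀ m X → Acc _⊂_ X → ¬ CliqueIn X (2 + m) → ColourableOn X (f (1 + m))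
      colour-acc zero X _ no-edge = weaken-colours 1≤f1 ((λ _ → zero) ,
        λ u v u∈ v∈ u~v _ → no-edge (add-to-clique (add-to-clique ((λ ()) , (λ ()) , λ ()) v∈ λ ())
          u∈ λ { zero → u~v ; (suc ()) }))
      colour-acc (suc zero) X _ ¬q = triangle-free-case 0 X (¬q ∘ triangle⇒3-clique)
      colour-acc (suc (suc m)) X (acc rec) ¬q = reduce m X ¬q
        (λ Y Y⊂X → colour-acc (suc (suc m)) Y (rec Y⊂X))
        (λ Y → colour-acc (suc m) Y (⊂-wellFounded Y))
        (λ Y → colour-acc m Y (⊂-wellFounded Y))

    colour : ∀ m X → ¬ CliqueIn X (2 + m) → ColourableOn X (f (1 + m))
    colour m X = colour-acc m X (⊂-wellFounded X)

  -- Domination between closed neighbourhoods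

  Dominated : VertexSet → Vertex → Vertex → Set
  Dominated X u v = ∀ z → z ∈ˢ X → z ≂ u → z ≂ v

  dominated? : ∀ X u v → Dec (Dominated X u v)
  dominated? X u v = all? λ z → (z ∈? X) →-dec ((z ≂? u) →-dec (z ≂? v))

  private-neighbour : ∀ {X u v} → ¬ Dominated X u v → ∃ λ z → z ∈ˢ X × z ≂ u × ¬ z ≂ v
  private-neighbour {X} {u} {v} ¬dom
    with any? (λ z → (z ∈? X) ×-dec ((z ≂? u) ×-dec ¬? (z ≂? v)))
  ... | yes w = w
  ... | no ¬w = contradiction
    (λ z z∈ z≂u → decidable-stable (z ≂? v) λ z≄v → ¬w (z , z∈ , z≂u , z≄v)) ¬dom

  non-neighbour : ∀ {X a} → ¬ Reducible X → a ∈ˢ X → ∃ λ e → e ∈ˢ X × ¬ e ≂ a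
  non-neighbour {X} {a} irred a∈ with any? (λ e → (e ∈? X) ×-dec ¬? (e ≂? a))
  ... | yes w = w
  ... | no ¬w = contradiction
    (inj₁ (a , a∈ , λ x x∈ → decidable-stable (x ≂? a) λ x≄a → ¬w (x , x∈ , x≄a))) irred

  nbhd? : ∀ X a → Decidable (λ x → x ∈ˢ X × x ≂ a)
  nbhd? X a x = (x ∈? X) ×-dec (x ≂? a)

  N[_] : VertexSet → Vertex → VertexSet
  N[ X ] a = select (nbhd? X a)

  -- Otherwise no edge of `X` leaves the closed neighbourhood of `a`, and the empty cutset separates
  -- it from a non-neighbour of `a`.
  two-step-neighbour : ∀ {X a} → ¬ Reducible X → a ∈ˢ X →
    ∃ λ x → ∃ λ y → (x ∈ˢ X × y ∈ˢ X) × x ≂ a × y ~ x × ¬ y ≂ a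
  two-step-neighbour {X} {a} irred a∈
    with any? (λ x → any? λ y → ((x ∈? X) ×-dec (y ∈? X)) ×-dec (x ≂? a) ×-dec (y ~? x) ×-dec ¬? (y ≂? a))
  ... | yes w = w
  ... | no ¬w = let e , e∈ , e≄a = non-neighbour irred a∈ in contradiction
    (inj₂ (N[ X ] a ,
      (λ x x∈ → proj₁ (∈-select⁻ (nbhd? X a) x∈)) ,
      (a , ∈-select⁺ (nbhd? X a) (a∈ , inj₁ refl)) ,
      (e , e∈ , e≄a ∘ proj₂ ∘ ∈-select⁻ (nbhd? X a) , λ (d , d∈ , d~e) → closed d∈ e∈ d~e e≄a) ,
      λ x y x∈ (d , d∈ , d~x) _ _ → let x∈X , x∉ = ∈-∖⁻ x∈ in
        contradiction (λ x≂a → x∉ (∈-select⁺ (nbhd? X a) (x∈X , x≂a))) (closed d∈ x∈X d~x)))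
    irred
    where
    closed : ∀ {x y} → x ∈ˢ N[ X ] a → y ∈ˢ X → x ~ y → ¬ ¬ y ≂ a
    closed {x} {y} x∈ y∈ x~y y≄a = let x∈X , x≂a = ∈-select⁻ (nbhd? X a) x∈ in
      ¬w (x , y , (x∈X , y∈) , x≂a , ~-sym x~y , y≄a)

  -- The bull is the triangle `u v w` with pendants `p` at `u` and `q` at `v`; the hammer is the
  -- triangle `p q r` with the path `p x y`.
  SquareFree BullFree HammerFree : Set
  SquareFree = ∀ {a b c d} → a ~ b → b ~ c → c ~ d → d ~ a → a ≂ c ⊎ b ≂ d
  BullFree = ∀ {u v w p q} → u ~ v → v ~ w → w ~ u →
    p ~ u → ¬ p ≂ v → ¬ p ≂ w → q ~ v → ¬ q ≂ u → ¬ q ≂ w → ¬ p ≂ q → ⊥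
  HammerFree = ∀ {p q r x y} → p ~ q → q ~ r → r ~ p →
    x ~ p → ¬ x ≂ q → ¬ x ≂ r → y ~ x → ¬ y ≂ p → ¬ y ≂ q → ¬ y ≂ r → ⊥

  module SquareFreeProperties (square-free : SquareFree) where

    -- An edge from `a` to `b` would close the chordless four-cycle `a v w b`.
    apart : ∀ {v w a b} → v ~ w → a ~ v → ¬ a ≂ w → b ~ w → ¬ b ≂ v → ¬ a ≂ b
    apart v~w a~v a≄w b~w b≄v (inj₁ refl) = b≄v (inj₂ a~v)
    apart v~w a~v a≄w b~w b≄v (inj₂ a~b)  =
      [ a≄w , b≄v ∘ ≂-sym ]′ (square-free a~v v~w (~-sym b~w) (~-sym a~b))

    common-neighbours-adjacent : ∀ {a b x y} → ¬ a ≂ b → x ~ a → x ~ b → y ~ a → y ~ b → x ≂ y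
    common-neighbours-adjacent a≄b x~a x~b y~a y~b =
      [ (λ a≂b → contradiction a≂b a≄b) , id ]′ (square-free (~-sym x~a) x~b (~-sym y~b) y~a)

  -- Hammer-free graphs

  module HammerFreeStructure
    (square-free : SquareFree) (hammer-free : HammerFree)
    (X : VertexSet) (irreducible : ¬ Reducible X) where
    open SquareFreeProperties square-free

    -- Otherwise the triangle with the path `p x y` is a hammer: were `y` adjacent to `q` or `r`,
    -- that vertex would form an induced four-cycle with `p`, `x` and `y`.
    pendant-dominated : ∀ {p q r x y} → p ~ q → q ~ r → r ~ p →
                        x ~ p → ¬ x ≂ q → ¬ x ≂ r → y ~ x → y ≂ p
    pendant-dominated {p} {q} {r} {x} {y} p~q q~r r~p x~p x≄q x≄r y~x =
      decidable-stable (y ≂? p) λ y≄p →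
        hammer-free p~q q~r r~p x~p x≄q x≄r y~x y≄p
          (far p~q x≄q y≄p) (far (~-sym r~p) x≄r y≄p)
      where
      far : ∀ {q} → p ~ q → ¬ x ≂ q → ¬ y ≂ p → ¬ y ≂ q
      far p~q x≄q y≄p y≂q = apart x~p y~x y≄p (~-sym p~q) (x≄q ∘ ≂-sym) y≂q

    -- Otherwise the neighbours of `y` form a clique cutting `y` off from a non-neighbour.
    non-simplicial : ∀ {y} → y ∈ˢ X → ∃ λ p → ∃ λ q → p ~ y × q ~ y × ¬ p ≂ q
    non-simplicial {y} y∈
      with any? (λ p → any? λ q → (p ~? y) ×-dec (q ~? y) ×-dec ¬? (p ≂? q))
    ... | yes w = w
    ... | no ¬w = let e , e∈ , e≄y = non-neighbour irreducible y∈ in contradiction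
      (inj₂ (⁅ y ⁆ ,
        (λ x x∈ → subst (_∈ˢ X) (sym (x∈⁅y⁆⇒x≡y y x∈)) y∈) ,
        (y , x∈⁅x⁆ y) ,
        (e , e∈ , e≄y ∘ inj₁ ∘ x∈⁅y⁆⇒x≡y y , λ t → e≄y (inj₂ (touching t))) ,
        λ p q _ tp _ tq → decidable-stable (p ≂? q) λ p≄q → ¬w (p , q , touching tp , touching tq , p≄q)))
      irreducible
      where
      touching : ∀ {x} → Touches ⁅ y ⁆ x → x ~ y
      touching (d , d∈ , d~x) with refl ← x∈⁅y⁆⇒x≡y y d∈ = ~-sym d~x

    -- Take nonadjacent neighbours `p`, `q` of `y`. If `p` missed `a`, the triangle `x y p` with the
    -- path `x a v` would force `v ≂ x`; likewise for `q`. So both see `a`, and `a p y q` is an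
    -- induced four-cycle.
    no-missed-common-neighbour : ∀ {a x w v y} → y ∈ˢ X →
      a ~ x → x ~ w → w ~ a → v ~ a → ¬ v ≂ x → y ~ x → ¬ y ≂ a → ¬ ¬ y ≂ w
    no-missed-common-neighbour {a} {x} {w} {v} {y} y∈ a~x x~w w~a v~a v≄x y~x y≄a y≄w
      with non-simplicial y∈
    ... | p , q , p~y , q~y , p≄q = by-cases (p ≂? a) (q ≂? a)
      where
      y-dominated : ∀ {z} → z ~ y → z ≂ x
      y-dominated = pendant-dominated (~-sym a~x) (~-sym w~a) (~-sym x~w) y~x y≄a y≄w

      sees-a : ∀ {p q} → p ~ y → q ~ y → ¬ p ≂ q → ¬ ¬ p ≂ a
      sees-a {p} p~y q~y p≄q p≄a = v≄x (pendant-dominated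
        (~-sym y~x) (~-sym p~y) (≂⇒~ p≢x (y-dominated p~y)) a~x (y≄a ∘ ≂-sym) (p≄a ∘ ≂-sym) v~a)
        where
        p≢x : p ≢ x
        p≢x refl = p≄q (≂-sym (y-dominated q~y))

      adjacent : ∀ {p} → p ≂ a → p ~ y → p ~ a
      adjacent p≂a p~y = strict′ p≂a y≄a (~-sym p~y)

      by-cases : Dec (p ≂ a) → Dec (q ≂ a) → ⊥
      by-cases (no p≄a)  _         = sees-a p~y q~y p≄q p≄a
      by-cases _         (no q≄a)  = sees-a q~y p~y (p≄q ∘ ≂-sym) q≄a
      by-cases (yes p≂a) (yes q≂a) =
        [ p≄q , y≄a ∘ ≂-sym ]′
          (square-free (adjacent p≂a p~y) (~-sym (adjacent q≂a q~y)) q~y (~-sym p~y))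

    common-neighbour-sees : ∀ {a x w v y} → y ∈ˢ X →
      a ~ x → x ~ w → w ~ a → v ~ a → ¬ v ≂ x → y ~ x → ¬ y ≂ a → w ~ y
    common-neighbour-sees {w = w} {y = y} y∈ a~x x~w w~a v~a v≄x y~x y≄a =
      ~-sym (strict (decidable-stable (y ≂? w)
        (no-missed-common-neighbour y∈ a~x x~w w~a v~a v≄x y~x y≄a)) y≄a w~a)

    InTriangle : Vertex → Set
    InTriangle a = ∃ λ b → ∃ λ c → (a ∈ˢ X × b ∈ˢ X × c ∈ˢ X) × a ~ b × b ~ c × c ~ a

    -- If `x` missed both other corners of the triangle at `a`, it would be a pendant there, and `y`
    -- could not escape the closed neighbourhood of `a`.
    common-neighbour : ∀ {a x y} → InTriangle a → x ~ a → y ~ x → ¬ y ≂ a →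
                       ∃ λ w → w ∈ˢ X × x ~ w × w ~ a
    common-neighbour {a} {x} (b , c , (a∈ , b∈ , c∈) , a~b , b~c , c~a) x~a y~x y≄a
      with x ≂? b | x ≂? c
    ... | yes (inj₁ refl) | _ = c , c∈ , b~c , c~a
    ... | yes (inj₂ x~b)  | _ = b , b∈ , x~b , ~-sym a~b
    ... | no _ | yes (inj₁ refl) = b , b∈ , ~-sym b~c , ~-sym a~b
    ... | no _ | yes (inj₂ x~c)  = c , c∈ , x~c , c~a
    ... | no x≄b | no x≄c = contradiction (pendant-dominated a~b b~c c~a x~a x≄b x≄c y~x) y≄a

    N-⊂ : ∀ {a w y} → Dominated X a w → y ∈ˢ X → y ≂ w → ¬ y ≂ a → N[ X ] a ⊂ N[ X ] w
    N-⊂ {a} {w} {y} dom y∈ y≂w y≄a =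
      (λ z∈ → let z∈X , z≂a = ∈-select⁻ (nbhd? X a) z∈ in
        ∈-select⁺ (nbhd? X w) (z∈X , dom _ z∈X z≂a)) ,
      y , ∈-select⁺ (nbhd? X w) (y∈ , y≂w) , y≄a ∘ proj₂ ∘ ∈-select⁻ (nbhd? X a)

    ascend : ∀ {a} → InTriangle a → ∃ λ w → InTriangle w × N[ X ] a ⊂ N[ X ] w
    ascend {a} t@(_ , _ , (a∈ , _) , _) with two-step-neighbour irreducible a∈
    ... | x , y , (x∈ , y∈) , x≂a , y~x , y≄a
      with strict′ x≂a y≄a y~x
    ...   | x~a with common-neighbour t x~a y~x y≄a | dominated? X a x
    ...     | w , w∈ , x~w , w~a | yes dom =
      x , (w , a , (x∈ , w∈ , a∈) , x~w , w~a , ~-sym x~a) , N-⊂ dom y∈ (inj₂ y~x) y≄a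
    ...     | w , w∈ , x~w , w~a | no ¬dom =
      let v , _ , v≂a , v≄x = private-neighbour ¬dom in
      let dom , w~y = rise (strict v≂a v≄x (~-sym x~a)) v≄x in
      w , (a , x , (w∈ , a∈ , x∈) , w~a , ~-sym x~a , x~w) , N-⊂ dom y∈ (inj₂ (~-sym w~y)) y≄a
      where
      rise : ∀ {v} → v ~ a → ¬ v ≂ x → Dominated X a w × w ~ y
      rise v~a v≄x = dom , sees-y x~w w~a
        where
        sees-y : ∀ {w} → x ~ w → w ~ a → w ~ y
        sees-y x~w w~a = common-neighbour-sees y∈ (~-sym x~a) x~w w~a v~a v≄x y~x y≄a

        dom : Dominated X a w
        dom z z∈ (inj₁ refl) = inj₂ (~-sym w~a)
        dom z z∈ (inj₂ z~a) with z ≂? x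
        ... | yes (inj₁ refl) = inj₂ x~w
        -- Now `z`, like `w`, is a common neighbour of `a` and `x`, so both see `y`; the four-cycle
        -- `z a w y` needs the chord from `z` to `w`.
        ... | yes (inj₂ z~x) =
          [ id , (λ a≂y → contradiction (≂-sym a≂y) y≄a) ]′
            (square-free z~a (~-sym w~a) (sees-y x~w w~a) (~-sym (sees-y (~-sym z~x) z~a)))
        -- The same lemma with `a` and `x` exchanged: `y` now plays the part of `v`, and `z` that of
        -- `y`.
        ... | no z≄x = inj₂ (~-sym
          (common-neighbour-sees z∈ x~a (~-sym w~a) (~-sym x~w) y~x y≄a z~a z≄x))

    not-in-triangle : ∀ {a} → Acc (λ B A → A ⊂ B) (N[ X ] a) → ¬ InTriangle a
    not-in-triangle (acc rec) t with ascend t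
    ... | w , t′ , a⊂w = not-in-triangle (rec a⊂w) t′

    triangle-free : ¬ HasTriangle X
    triangle-free (a , b , c , ∈X , edges) =
      not-in-triangle (⊃-wellFounded (N[ X ] a)) (b , c , ∈X , edges)

  -- Bull-free graphs

  module BullFreeStructure
    (square-free : SquareFree) (bull-free : BullFree)
    (X : VertexSet) (irreducible : ¬ Reducible X) where
    open SquareFreeProperties square-free

    module DominationIsTwinning {u v : Vertex} (u∈ : u ∈ˢ X) (v∈ : v ∈ˢ X)
      (u-dominated : Dominated X u v) where

      out? : Decidable (λ z → z ∈ˢ X × ¬ z ≂ v)
      out? z = (z ∈? X) ×-dec ¬? (z ≂? v)

      Outside : VertexSet
      Outside = select out?

      Boundary : Vertex → Set
      Boundary a = a ∈ˢ X × a ~ v × ∃ λ z → z ∈ˢ X × ¬ z ≂ v × z ~ a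

      boundary : ∀ {a} → a ∈ˢ X ∖ Outside → Touches Outside a → Boundary a
      boundary {a} a∈ (z , z∈ , z~a) =
        let a∈X , a∉ = ∈-∖⁻ a∈ ; z∈X , z≄v = ∈-select⁻ out? z∈
            a≂v = decidable-stable (a ≂? v) λ a≄v → a∉ (∈-select⁺ out? (a∈X , a≄v))
        in a∈X , strict′ a≂v z≄v z~a , z , z∈X , z≄v , z~a

      -- Outside would otherwise be separated from v by its boundary.
      nonadjacent-boundary : ∃ λ a → ∃ λ b → Boundary a × Boundary b × ¬ a ≂ b
      nonadjacent-boundary
        with any? (λ a → any? λ b → ((a ∈? (X ∖ Outside)) ×-dec touches? Outside a) ×-dec
                    ((b ∈? (X ∖ Outside)) ×-dec touches? Outside b) ×-dec ¬? (a ≂? b))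
      ... | yes (a , b , (a∈ , ta) , (b∈ , tb) , a≄b) = a , b , boundary a∈ ta , boundary b∈ tb , a≄b
      ... | no ¬w = let e , e∈ , e≄v = non-neighbour irreducible v∈ in contradiction
        (inj₂ (Outside ,
          (λ x x∈ → proj₁ (∈-select⁻ out? x∈)) ,
          (e , ∈-select⁺ out? (e∈ , e≄v)) ,
          (v , v∈ , (λ v∈ → proj₂ (∈-select⁻ out? v∈) (inj₁ refl)) ,
            λ (z , z∈ , z~v) → proj₂ (∈-select⁻ out? z∈) (inj₂ z~v)) ,
          λ a b a∈ ta b∈ tb → decidable-stable (a ≂? b) λ a≄b → ¬w (a , b , (a∈ , ta) , (b∈ , tb) , a≄b)))
        irreducible

      -- Otherwise the triangle p b v, with a pendant edge from b leading
      -- outside and one from v to c, is a bull.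
      transfer : ∀ {p b c} → p ∈ˢ X → Dominated X p v → Boundary b → c ~ v → ¬ b ≂ c → p ~ b → p ~ c
      transfer {p} {b} {c} p∈ p-dom (_ , b~v , z , z∈ , z≄v , z~b) c~v b≄c p~b =
        strict′ (decidable-stable (p ≂? c) λ p≄c →
          bull-free b~v (~-sym (p~v p≄c)) p~b
            z~b z≄v (z≄v ∘ p-dom z z∈)
            c~v (b≄c ∘ ≂-sym) (p≄c ∘ ≂-sym) (apart b~v z~b z≄v c~v (b≄c ∘ ≂-sym))) b≄c (~-sym p~b)
        where
        p~v : ¬ p ≂ c → p ~ v
        p~v p≄c = strict (p-dom p p∈ (inj₁ refl)) p≄c (~-sym c~v)

      module _ {a b : Vertex} (∂a : Boundary a) (∂b : Boundary b) (a≄b : ¬ a ≂ b) where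

        -- By `transfer`, `u` also sees `b`. A neighbour `x` of `v` missed by `u` must see `a` and
        -- `b`, since `transfer` would otherwise make `u` adjacent to `x`. Then `u` and `x` are
        -- common neighbours of the nonadjacent `a` and `b`, hence adjacent.
        twin-if-adjacent : u ~ a → Dominated X v u
        twin-if-adjacent u~a x x∈ x≂v = decidable-stable (x ≂? u) λ x≄u →
          let u~b = transfer u∈ u-dominated ∂a (proj₁ (proj₂ ∂b)) a≄b u~a
              u~v = ≂⇒~ (λ { refl → x≄u x≂v }) (u-dominated u u∈ (inj₁ refl))
              x~v = strict x≂v x≄u (~-sym u~v)
              sees : ∀ {c} → Boundary c → u ~ c → x ~ c
              sees = λ {c} ∂c u~c → strict
                (decidable-stable (x ≂? c) λ x≄c →
                  x≄u (inj₂ (~-sym (transfer u∈ u-dominated ∂c x~v (x≄c ∘ ≂-sym) u~c)))) x≄u (~-sym u~c)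
          in x≄u (common-neighbours-adjacent a≄b (sees ∂a u~a) (sees ∂b u~b) u~a u~b)

      Remote : Vertex → Vertex → Vertex → Set
      Remote a b p = p ∈ˢ X × Dominated X p v × ¬ p ≂ a × ¬ p ≂ b

      remote? : ∀ a b → Decidable (Remote a b)
      remote? a b p = (p ∈? X) ×-dec (dominated? X p v ×-dec (¬? (p ≂? a) ×-dec ¬? (p ≂? b)))

      boundary-undominated : ∀ {a} → Boundary a → ¬ Dominated X a v
      boundary-undominated (_ , _ , z , z∈ , z≄v , z~a) dom = z≄v (dom z z∈ (inj₂ z~a))

      -- Suppose `x` misses `a`. If `v` did not dominate `x`, then `x` would be a boundary vertex
      -- and `transfer` would give `p ~ a`. So `v` dominates `x`, and `x` misses `b`, as `transfer`
      -- would carry an edge to `b` over to `a`. Thus `x` would be remote.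
      remote-neighbour-sees : ∀ {a b p x} → Boundary a → Boundary b → ¬ a ≂ b →
        Remote a b p → x ∈ˢ X → p ~ x → ¬ Remote a b x → x ~ a
      remote-neighbour-sees {a} {b} {p} {x} ∂a ∂b a≄b (p∈ , p-dom , p≄a , p≄b) x∈ p~x x-near =
        strict′ (decidable-stable (x ≂? a) λ x≄a → x-near (x∈ ,
          x-dominated x≄a , x≄a ,
          λ x≂b → x≄a (inj₂ (transfer x∈ (x-dominated x≄a) ∂b (proj₁ (proj₂ ∂a)) (a≄b ∘ ≂-sym)
            (≂⇒~ (λ { refl → boundary-undominated ∂b (x-dominated x≄a) }) x≂b))))) p≄a p~x
        where
        x≂v : x ≂ v
        x≂v = p-dom x x∈ (inj₂ (~-sym p~x))

        x-dominated : ¬ x ≂ a → Dominated X x v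
        x-dominated x≄a with dominated? X x v
        ... | yes dom = dom
        ... | no ¬dom =
          let z , z∈ , z≂x , z≄v = private-neighbour ¬dom
              z~x = ≂⇒~ (λ z≡x → z≄v (subst (_≂ v) (sym z≡x) x≂v)) z≂x
              x~v = strict′ x≂v z≄v z~x
          in contradiction
               (inj₂ (transfer p∈ p-dom (x∈ , x~v , z , z∈ , z≄v , z~x) (proj₁ (proj₂ ∂a)) x≄a p~x))
               p≄a

      -- Otherwise Remote a b contains u, and its neighbours are common
      -- neighbours of a and b, hence a clique separating u from a.
      adjacent-to-boundary : ∀ {a b} → Boundary a → Boundary b → ¬ a ≂ b → u ~ a
      adjacent-to-boundary {a} {b} ∂a ∂b a≄b = decidable-stable (u ~? a) λ u≁a → irreducible
        (inj₂ (R ,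
          (λ x x∈ → proj₁ (∈-select⁻ R? x∈)) ,
          (u , ∈-select⁺ R? (u∈ , u-dominated ,
            [ (λ { refl → boundary-undominated ∂a u-dominated }) , u≁a ]′ ,
            [ (λ { refl → boundary-undominated ∂b u-dominated }) ,
              u≁a ∘ transfer u∈ u-dominated ∂b (proj₁ (proj₂ ∂a)) (a≄b ∘ ≂-sym) ]′)) ,
          (a , proj₁ ∂a , (λ a∈ → proj₁ (proj₂ (proj₂ (∈-select⁻ R? a∈))) (inj₁ refl)) ,
            λ (d , d∈ , d~a) → proj₁ (proj₂ (proj₂ (∈-select⁻ R? d∈))) (inj₂ d~a)) ,
          λ x y x∈ tx y∈ ty → common-neighbours-adjacent a≄b
            (sees-a x∈ tx) (sees-b x∈ tx) (sees-a y∈ ty) (sees-b y∈ ty)))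
        where
        R? = remote? a b
        R  = select R?

        sees-a : ∀ {x} → x ∈ˢ X ∖ R → Touches R x → x ~ a
        sees-a x∈ (p , p∈ , p~x) = let x∈X , x∉R = ∈-∖⁻ x∈ in
          remote-neighbour-sees ∂a ∂b a≄b (∈-select⁻ R? p∈) x∈X p~x (x∉R ∘ ∈-select⁺ R?)

        sees-b : ∀ {x} → x ∈ˢ X ∖ R → Touches R x → x ~ b
        sees-b x∈ (p , p∈ , p~x) =
          let x∈X , x∉R = ∈-∖⁻ x∈ ; p∈X , p-dom , p≄a , p≄b = ∈-select⁻ R? p∈ in
          remote-neighbour-sees ∂b ∂a (a≄b ∘ ≂-sym) (p∈X , p-dom , p≄b , p≄a) x∈X p~x
            λ (x∈X , x-dom , x≄b , x≄a) → x∉R (∈-select⁺ R? (x∈X , x-dom , x≄a , x≄b))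

      twin : Dominated X v u
      twin with nonadjacent-boundary
      ... | _ , _ , ∂a , ∂b , a≄b = twin-if-adjacent ∂a ∂b a≄b (adjacent-to-boundary ∂a ∂b a≄b)

    Private : Vertex → Vertex → Vertex → Set
    Private x y p = p ≂ x × ¬ p ≂ y

    -- In this 3-sun, the triangle `u v a` with pendants `b` at `u` and `c` at `v` is a bull.
    sun-free : ∀ {u v w a b c} → u ~ v → v ~ w → w ~ u →
      a ~ u → a ~ v → ¬ a ≂ w → b ~ u → b ~ w → ¬ b ≂ v → c ~ v → c ~ w → ¬ c ≂ u → ⊥
    sun-free u~v v~w w~u a~u a~v a≄w b~u b~w b≄v c~v c~w c≄u =
      bull-free u~v (~-sym a~v) a~u
        b~u b≄v (apart v~w a~v a≄w b~w b≄v ∘ ≂-sym)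
        c~v c≄u (apart (~-sym w~u) a~u a≄w c~w c≄u ∘ ≂-sym)
        (apart u~v b~u b≄v c~v c≄u)

    -- Each of `q`, `r`, `s` sees a second corner, as otherwise it and `p` would be the pendants of
    -- a bull. The three then complete a 3-sun.
    no-corner-pendant : ∀ {u v w p q r s} → u ~ v → v ~ w → w ~ u →
      p ~ u → ¬ p ≂ v → ¬ p ≂ w →
      Private v w q → Private v u r → Private w v s → ⊥
    no-corner-pendant {u} {v} {w} {p} {q} {r} {s} u~v v~w w~u p~u p≄v p≄w (q≂v , q≄w) (r≂v , r≄u) (s≂w , s≄v) =
      sun-free u~v v~w w~u q~u q~v q≄w s~u s~w s≄v r~v r~w r≄u
      where
      q~v = strict q≂v q≄w v~w
      r~v = strict r≂v r≄u (~-sym u~v)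
      s~w = strict s≂w s≄v (~-sym v~w)
      q~u : q ~ u
      q~u = strict (decidable-stable (q ≂? u) λ q≄u →
        bull-free u~v v~w w~u p~u p≄v p≄w q~v q≄u q≄w (apart u~v p~u p≄v q~v q≄u)) q≄w (~-sym w~u)
      s~u : s ~ u
      s~u = strict (decidable-stable (s ≂? u) λ s≄u →
        bull-free (~-sym w~u) (~-sym v~w) (~-sym u~v) p~u p≄w p≄v s~w s≄u s≄v
          (apart (~-sym w~u) p~u p≄w s~w s≄u)) s≄v u~v
      r~w : r ~ w
      r~w = strict (decidable-stable (r ≂? w) λ r≄w →
        bull-free u~v v~w w~u p~u p≄v p≄w r~v r≄u r≄w (apart u~v p~u p≄v r~v r≄u)) r≄u w~u

    no-triangle-of-private-neighbours : ∀ {F} →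
      (∀ {x y} → x ∈ˢ F → y ∈ˢ F → x ~ y → ∃ (Private x y)) → ¬ HasTriangle F
    no-triangle-of-private-neighbours priv (u , v , w , (u∈ , v∈ , w∈) , (u~v , v~w , w~u))
      with priv v∈ w∈ v~w | priv w∈ v∈ (~-sym v~w) | priv v∈ u∈ (~-sym u~v)
         | priv u∈ v∈ u~v | priv u∈ w∈ (~-sym w~u) | priv w∈ u∈ w~u
    ... | a , a≂v , a≄w | b , vb@(b≂w , b≄v) | c , vc@(c≂v , c≄u) | _ , ud | _ , ue | _ , wg
      -- Either all three see a second corner and form a 3-sun, or one of them is a pendant at a
      -- single corner.
      with a ≂? u | b ≂? u | c ≂? w
    ... | yes a≂u | yes b≂u | yes c≂w = sun-free u~v v~w w~u
      (strict a≂u a≄w (~-sym w~u)) (strict a≂v a≄w v~w) a≄w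
      (strict b≂u b≄v u~v) (strict b≂w b≄v (~-sym v~w)) b≄v
      (strict c≂v c≄u (~-sym u~v)) (strict c≂w c≄u w~u) c≄u
    ... | no a≄u | _ | _ = no-corner-pendant v~w w~u u~v
      (strict a≂v a≄w v~w) a≄w a≄u wg vb ue
    ... | _ | no b≄u | _ = no-corner-pendant w~u u~v v~w
      (strict b≂w b≄v (~-sym v~w)) b≄u b≄v ud ue vc
    ... | _ | _ | no c≄w = no-corner-pendant v~w w~u u~v
      (strict c≂v c≄u (~-sym u~v)) c≄w c≄u wg vb ue

    Twin : Vertex → Vertex → Set
    Twin u v = Dominated X u v × Dominated X v u

    twin? : ∀ u v → Dec (Twin u v)
    twin? u v = dominated? X u v ×-dec dominated? X v u

    -- The member of least index in its class of twins.
    Representative : Vertex → Set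
    Representative r = r ∈ˢ X × ¬ ∃ λ u → u ∈ˢ X × u Fin.< r × Twin u r

    representative? : Decidable Representative
    representative? r = (r ∈? X) ×-dec
      ¬? (any? λ u → (u ∈? X) ×-dec ((u Fin.<? r) ×-dec twin? u r))

    Representatives : VertexSet
    Representatives = select representative?

    representative : ∀ {v} → v ∈ˢ X → ∃ λ r → r ∈ˢ Representatives × Twin v r
    representative {v} = go (<-wellFounded v)
      where
      go : ∀ {v} → Acc Fin._<_ v → v ∈ˢ X → ∃ λ r → r ∈ˢ Representatives × Twin v r
      go {v} (acc rec) v∈ with any? (λ u → (u ∈? X) ×-dec ((u Fin.<? v) ×-dec twin? u v))
      ... | no ¬smaller = v , ∈-select⁺ representative? (v∈ , ¬smaller) , (λ _ _ → id) , λ _ _ → id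
      ... | yes (u , u∈ , u<v , u⊑v , v⊑u) =
        let r , r∈ , u⊑r , r⊑u = go (rec u<v) u∈ in
        r , r∈ , (λ z z∈ → u⊑r z z∈ ∘ v⊑u z z∈) , λ z z∈ → u⊑v z z∈ ∘ r⊑u z z∈

    -- Adjacent representatives are distinct, hence not twins. Since domination implies twinning,
    -- neither dominates the other, so private neighbours exist in both directions.
    representatives-triangle-free : ¬ HasTriangle Representatives
    representatives-triangle-free = no-triangle-of-private-neighbours λ {x} {y} x∈ y∈ x~y →
      let x∈X , x-least = ∈-select⁻ representative? x∈
          y∈X , y-least = ∈-select⁻ representative? y∈
          z , _ , z≂x , z≄y = private-neighbour λ x⊑y →
            let y⊑x = DominationIsTwinning.twin x∈X y∈X x⊑y in
            case-< x~y (λ x<y → y-least (x , x∈X , x<y , x⊑y , y⊑x))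
                       (λ y<x → x-least (y , y∈X , y<x , y⊑x , x⊑y))
      in z , z≂x , z≄y
      where
      case-< : ∀ {x y} → x ~ y → ¬ x Fin.< y → ¬ y Fin.< x → ⊥
      case-< {x} {y} x~y x≮y y≮x with Fin.<-cmp x y
      ... | tri< x<y _ _ = x≮y x<y
      ... | tri≈ _ x≡y _ = ~-irr x≡y x~y
      ... | tri> _ _ y<x = y≮x y<x

    -- Take the representatives of the class of `q zero` and of another class whose members see the
    -- whole clique. They differ from every `q i`, as the clique avoids representatives.
    clique-extends : ∀ {m} ((q , _) : CliqueIn (X ∖ Representatives) (suc m)) → ∃ λ p → ∃ λ r →
      p ∈ˢ X × r ∈ˢ X × p ~ r × (∀ i → p ~ q i) × (∀ i → r ~ q i)
    clique-extends {m} (q , clique , q∈) =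
      let r , r∈ , v⊑r , r⊑v = representative (q∈X zero)
          u , u∈ , u≂q , ¬twin = other-class
          s , s∈ , u⊑s , s⊑u = representative u∈
      in r , s , ∈X r∈ , ∈X s∈ ,
         twins-adjacent (q∈X zero) (∈X s∈) (v⊑r , r⊑v) (u⊑s , s⊑u) (u≂q zero) ¬twin ,
         joins r∈ v⊑r (λ i → q≂q i zero) , joins s∈ u⊑s (≂-sym ∘ u≂q)
      where
      q∈X : ∀ i → q i ∈ˢ X
      q∈X i = proj₁ (∈-∖⁻ (q∈ i))

      ∈X : ∀ {r} → r ∈ˢ Representatives → r ∈ˢ X
      ∈X r∈ = proj₁ (∈-select⁻ representative? r∈)

      q≢ : ∀ i {r} → r ∈ˢ Representatives → q i ≢ r
      q≢ i r∈ eq = proj₂ (∈-∖⁻ (q∈ i)) (subst (_∈ˢ Representatives) (sym eq) r∈)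

      q≂q : ∀ i j → q i ≂ q j
      q≂q i j with i ≟ j
      ... | yes refl = inj₁ refl
      ... | no i≢j   = inj₂ (clique i j i≢j)

      joins : ∀ {u r} → r ∈ˢ Representatives → Dominated X u r → (∀ i → q i ≂ u) → ∀ i → r ~ q i
      joins r∈ u⊑r q≂u i = ~-sym (≂⇒~ (q≢ i r∈) (u⊑r _ (q∈X i) (q≂u i)))

      twins-adjacent : ∀ {u v r s} → v ∈ˢ X → s ∈ˢ X → Twin v r → Twin u s →
                       u ≂ v → ¬ Twin u v → r ~ s
      twins-adjacent {r = r} {s} v∈ s∈ (v⊑r , r⊑v) (u⊑s , s⊑u) u≂v ¬twin =
        ~-sym (≂⇒~ s≢r (v⊑r _ s∈ (≂-sym (u⊑s _ v∈ (≂-sym u≂v)))))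
        where
        s≢r : s ≢ r
        s≢r refl = ¬twin ((λ z z∈ → r⊑v z z∈ ∘ u⊑s z z∈) , λ z z∈ → s⊑u z z∈ ∘ v⊑r z z∈)

      other-class : ∃ λ u → u ∈ˢ X × (∀ i → u ≂ q i) × ¬ Twin u (q zero)
      other-class with any? (λ i → ¬? (twin? (q i) (q zero)))
      ... | yes (i , ¬twin) = q i , q∈X i , q≂q i , ¬twin
      -- The clique lies in one class. Its common neighbour `x` is in another, because `x` has a
      -- neighbour `y` that the clique misses.
      ... | no all-twins =
        let x , y , (x∈ , y∈) , x≂v , y~x , y≄v = two-step-neighbour irreducible (q∈X zero) in
        x , x∈ ,
        (λ i → proj₂ (decidable-stable (twin? (q i) (q zero)) λ ¬t → all-twins (i , ¬t)) x x∈ x≂v) ,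
        λ (x⊑v , _) → y≄v (x⊑v y y∈ (inj₂ y~x))

    representatives-transversal : DoubleTransversal X Representatives
    representatives-transversal = representatives-triangle-free , clique-extends

  -- Chromatic number, clique number and induced subgraphs

  colour-bound : ∀ (f : ℕ → ℕ) →
    (∀ m X → ¬ CliqueIn X (2 + m) → ColourableOn X (f (1 + m))) → χ G ≤ f (ω G)
  colour-bound f col = go (ω G) refl
    where
    χ-least : ∀ c → Colourable G c → χ G ≤ c
    χ-least = proj₂ (proj₂ (chromaticNumber G))

    ω-greatest : ∀ m → HasClique G m → m ≤ ω G
    ω-greatest = proj₂ (proj₂ (cliqueNumber G))

    go : ∀ w → ω G ≡ w → χ G ≤ f w
    -- Clique number zero means no vertices, so zero colours suffice whatever `f 0` is.
    go zero ω≡0 = ≤-trans (χ-least 0 (⊥-elim ∘ empty , λ u → ⊥-elim (empty u))) z≤n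
      where
      empty : Vertex → ⊥
      empty u with () ← subst (1 ≤_) ω≡0
        (ω-greatest 1 ((λ _ → u) , λ { zero zero 0≢0 → contradiction refl 0≢0 }))
    go (suc m) ω≡ =
      let φ , proper = col m ⊤ λ (q , clique , _) →
            1+n≰n (subst (2 + m ≤_) ω≡ (ω-greatest (2 + m) (q , clique)))
      in χ-least _ (φ , λ u v u~v → proper u v ∈⊤ ∈⊤ u~v)

  module _ (X : VertexSet) where

    private
      vertices : List Vertex
      vertices = filter (_∈? X) (allFin order)

      index : ∀ {u} → u ∈ˢ X → Fin (length vertices)
      index {u} u∈ = Any.index (∈-filter⁺ (_∈? X) (∈-allFin u) u∈)

      lookup-index′ : ∀ {u} (u∈ : u ∈ˢ X) → u ≡ lookup vertices (index u∈)
      lookup-index′ {u} u∈ = lookup-index (∈-filter⁺ (_∈? X) (∈-allFin u) u∈)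

      lookup∈ : ∀ i → lookup vertices i ∈ˢ X
      lookup∈ i = proj₂ (∈-filter⁻ (_∈? X) {xs = allFin order} (∈-lookup i))

    enumeration : Fin (length vertices) ↣ Vertex
    enumeration = mk↣ (lookup-injective (filter⁺ (_∈? X) (allFin⁺ order)) _ _)

    induced-ω≤2 : ¬ HasTriangle X → ω (induced G enumeration) ≤ 2
    induced-ω≤2 ¬t = ≮⇒≥ λ 3≤ω →
      let q , clique = proj₁ (proj₂ (cliqueNumber (induced G enumeration)))
          g = λ i → q (inject≤ i 3≤ω)
          edge = λ i j i≢j → clique (inject≤ i 3≤ω) (inject≤ j 3≤ω)
                   (i≢j ∘ inject≤-injective 3≤ω 3≤ω i j)
      in ¬t (lookup vertices (g 0F) , lookup vertices (g 1F) , lookup vertices (g 2F) ,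
             (lookup∈ (g 0F) , lookup∈ (g 1F) , lookup∈ (g 2F)) ,
             edge 0F 1F (λ ()) , edge 1F 2F (λ ()) , edge 2F 0F (λ ()))

    induced-colouring : ∀ {c} → 1 ≤ c → Colourable (induced G enumeration) c → ColourableOn X c
    induced-colouring {suc c} _ (φ , proper) = ψ , ψ-proper
      where
      ψ : Vertex → Fin (suc c)
      ψ u with u ∈? X
      ... | yes u∈ = φ (index u∈)
      -- A default colour outside `X`, available because `c` is positive.
      ... | no _   = zero

      ψ-proper : ProperOn X ψ
      ψ-proper u v u∈ v∈ u~v with u ∈? X | v ∈? X
      ... | yes u∈′ | yes v∈′ = proper _ _
        (subst₂ _~_ (lookup-index′ u∈′) (lookup-index′ v∈′) u~v)
      ... | no u∉   | _       = contradiction u∈ u∉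
      ... | _       | no v∉   = contradiction v∈ v∉

  triangle-free-colouring : ∀ {ℓ} (𝓕 : Pred Graph ℓ) → Hereditary 𝓕 → G ∈ 𝓕 →
    ∀ {k} → 1 ≤ k → (∀ F → F ∈ 𝓕 → ω F ≤ 2 → χ F ≤ k) →
    ∀ X → ¬ HasTriangle X → ColourableOn X k
  triangle-free-colouring 𝓕 hereditary G∈ 1≤k bound X ¬t =
    let F = induced G (enumeration X)
        χ≤k = bound F (hereditary G (enumeration X) G∈) (induced-ω≤2 X ¬t)
        φ , proper = proj₁ (proj₂ (chromaticNumber F))
    in induced-colouring X 1≤k ((λ u → inject≤ (φ u) χ≤k) ,
         λ u v u~v → proper u v u~v ∘ inject≤-injective χ≤k χ≤k _ _)

  -- Recognising the forbidden graphs as induced subgraphs.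

  module Pattern (T : Graph) where
    private module T = Graph T

    -- The Boolean test computes for a concrete `T`, so each table entry becomes a plain adjacency
    -- or its negation. Using `≂` in the latter makes `F` injective.
    Realised : (T.Vertex → Vertex) → T.Vertex → T.Vertex → Set
    Realised F i j = if does (i T.~? j) then F i ~ F j else (¬ F i ≂ F j)

    module _ (F : T.Vertex → Vertex) (realised : ForPairs (Realised F)) where

      realised-cases : ∀ i j → i ≡ j ⊎ (i T.~ j × F i ~ F j) ⊎ (¬ i T.~ j × ¬ F i ≂ F j)
      realised-cases i j with Fin.<-cmp i j
      ... | tri≈ _ i≡j _ = inj₁ i≡j
      ... | tri< i<j _ _ with i T.~? j | for-pair realised i<j
      ...   | yes e | r = inj₂ (inj₁ (e , r))
      ...   | no ¬e | r = inj₂ (inj₂ (¬e , r))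
      realised-cases i j | tri> _ _ j<i with j T.~? i | for-pair realised j<i
      ...   | yes e | r = inj₂ (inj₁ (T.~-sym e , ~-sym r))
      ...   | no ¬e | r = inj₂ (inj₂ (¬e ∘ T.~-sym , r ∘ ≂-sym))

      realised-injective : ∀ {i j} → F i ≡ F j → i ≡ j
      realised-injective {i} {j} eq with realised-cases i j
      ... | inj₁ i≡j             = i≡j
      ... | inj₂ (inj₁ (_ , e))  = contradiction e (~-irr eq)
      ... | inj₂ (inj₂ (_ , ¬e)) = contradiction (inj₁ eq) ¬e

      realised-adjacency : ∀ i j → (F i ~ F j) ⇔ (i T.~ j)
      realised-adjacency i j with realised-cases i j
      ... | inj₁ refl             = mk⇔ (⊥-elim ∘ ~-irr refl) (⊥-elim ∘ T.~-irr refl)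
      ... | inj₂ (inj₁ (t , e))   = mk⇔ (const t) (const e)
      ... | inj₂ (inj₂ (¬t , ¬e)) = mk⇔ (⊥-elim ∘ ¬e ∘ inj₂) (⊥-elim ∘ ¬t)

      -- Precomposing with the isomorphism numbers the copy by the vertices of `H`, so the identity
      -- identifies it with `H`.
      realised⇒induced : ∀ {H} → H ≅ T → ∃ λ m → ∃ λ (f : Fin m ↣ Vertex) → induced G f ≅ H
      realised⇒induced {H} iso =
        _ , mk↣ {to = F ∘ to} (Injection.injective (Inverse⇒Injection bijection) ∘ realised-injective) , record
          { bijection = ↔-id _
          ; adjacency = λ u v → ⇔-sym (adjacency u v) ⇔-∘ realised-adjacency (to u) (to v)
          }
        where
        open _≅_ iso
        open Inverse bijection using (to)

  InducedFree : Graph → Set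
  InducedFree H = ∀ {m} (f : Fin m ↣ Vertex) → ¬ (induced G f ≅ H)

  C₄-free⇒square-free : InducedFree C₄ → SquareFree
  C₄-free⇒square-free free {a} {b} {c} {d} a~b b~c c~d d~a with a ≂? c | b ≂? d
  ... | yes a≂c | _       = inj₁ a≂c
  ... | _       | yes b≂d = inj₂ b≂d
  ... | no a≄c  | no b≄d  =
    let _ , f , iso = Pattern.realised⇒induced C₄ (Vec.lookup (a ∷ b ∷ c ∷ d ∷ []))
          ( (λ { 0F → a~b ; 1F → a≄c ; 2F → ~-sym d~a })
          , (λ { 0F → b~c ; 1F → b≄d })
          , (λ { 0F → c~d })
          , (λ ())
          , tt )
          record { bijection = ↔-id _ ; adjacency = λ _ _ → ⇔-id _ }
    in contradiction iso (free f)

  bull-free : ∀ {H} → H ≅ bull → InducedFree H → BullFree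
  bull-free H≅ free {u} {v} {w} {p} {q} u~v v~w w~u p~u p≄v p≄w q~v q≄u q≄w p≄q =
    let _ , f , iso = Pattern.realised⇒induced bull (Vec.lookup (u ∷ v ∷ w ∷ p ∷ q ∷ []))
          ( (λ { 0F → u~v ; 1F → ~-sym w~u ; 2F → ~-sym p~u ; 3F → q≄u ∘ ≂-sym })
          , (λ { 0F → v~w ; 1F → p≄v ∘ ≂-sym ; 2F → ~-sym q~v })
          , (λ { 0F → p≄w ∘ ≂-sym ; 1F → q≄w ∘ ≂-sym })
          , (λ { 0F → p≄q })
          , (λ ())
          , tt )
          H≅
    in free f iso

  hammer-free : ∀ {H} → H ≅ hammer → InducedFree H → HammerFree
  hammer-free H≅ free {p} {q} {r} {x} {y} p~q q~r r~p x~p x≄q x≄r y~x y≄p y≄q y≄r =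
    let _ , f , iso = Pattern.realised⇒induced hammer (Vec.lookup (p ∷ q ∷ r ∷ x ∷ y ∷ []))
          ( (λ { 0F → p~q ; 1F → ~-sym r~p ; 2F → ~-sym x~p ; 3F → y≄p ∘ ≂-sym })
          , (λ { 0F → q~r ; 1F → x≄q ∘ ≂-sym ; 2F → y≄q ∘ ≂-sym })
          , (λ { 0F → x≄r ∘ ≂-sym ; 1F → y≄r ∘ ≂-sym })
          , (λ { 0F → ~-sym y~x })
          , (λ ())
          , tt )
          H≅
    in free f iso

-- Arithmetic of the two bounds and conclusion.

⌊n*2+m/2⌋ : ∀ n m → ⌊ n * 2 + m /2⌋ ≡ n + ⌊ m /2⌋
⌊n*2+m/2⌋ zero    m = refl
⌊n*2+m/2⌋ (suc n) m = cong suc (⌊n*2+m/2⌋ n m)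

2*⌊n/2⌋≤n : ∀ n → 2 * ⌊ n /2⌋ ≤ n
2*⌊n/2⌋≤n zero          = z≤n
2*⌊n/2⌋≤n (suc zero)    = z≤n
2*⌊n/2⌋≤n (suc (suc n)) rewrite +-suc ⌊ n /2⌋ (⌊ n /2⌋ + 0) = s≤s (s≤s (2*⌊n/2⌋≤n n))

module _ {ℓ : Level} (H : Graph) (k : ℕ) (2≤k : 2 ≤ k)
  (𝓕 : Pred Graph ℓ) (hereditary : Hereditary 𝓕)
  (bound : ∀ F → F ∈ 𝓕 → ω F ≤ 2 → χ F ≤ k)
  (G : Graph) (C₄-free : InducedFree G C₄) (H-free : InducedFree G H) (G∈ : G ∈ 𝓕) where

  private
    square-free : SquareFree G
    square-free = C₄-free⇒square-free G C₄-free

    colour-triangle-free : ∀ X → ¬ HasTriangle G X → ColourableOn G X k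
    colour-triangle-free =
      triangle-free-colouring G 𝓕 hereditary G∈ (≤-trans (s≤s z≤n) 2≤k) bound

  bull-bound : H ≅ bull → 2 * χ G ≤ k * ω G
  bull-bound H≅ = ≤-trans (*-monoʳ-≤ 2 χ≤) (2*⌊n/2⌋≤n (k * ω G))
    where
    f : ℕ → ℕ
    f m = ⌊ k * m /2⌋

    -- Since `k` is at least two, `k * m` grows by at least two, which survives halving as one.
    f-suc : ∀ m → suc (f m) ≤ f (suc m)
    f-suc m rewrite *-suc k m = ⌊n/2⌋-mono (+-monoˡ-≤ (k * m) 2≤k)

    f-double : ∀ m → k + f m ≡ f (2 + m)
    f-double m = trans (sym (⌊n*2+m/2⌋ k (k * m))) (cong ⌊_/2⌋ (sym (*-distribˡ-+ k 2 m)))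

    decompose : ∀ X → HasTriangle G X →
      Reducible G X ⊎ (∃ (DoubleTransversal G X) × (∀ m → k + f m ≤ f (2 + m)))
    decompose X _ with reducible? G X
    ... | yes red = inj₁ red
    ... | no irred = inj₂ ((_ , BullFreeStructure.representatives-transversal G square-free
                                  (bull-free G H≅ H-free) X irred) , ≤-reflexive ∘ f-double)

    χ≤ : χ G ≤ f (ω G)
    χ≤ = colour-bound G f (colour G f (≤-trans (s≤s z≤n) (f-suc 0)) f-suc k
      (≤-trans (m≤m+n k (f 0)) (≤-reflexive (f-double 0))) colour-triangle-free decompose)

  hammer-bound : H ≅ hammer → χ G ≤ (ω G + k) ∸ 2
  hammer-bound H≅ = subst (χ G ≤_) (sym (+-∸-assoc (ω G) 2≤k)) (colour-bound G f
    (colour G f (s≤s z≤n) (λ _ → ≤-refl) k (≤-reflexive (sym (m+[n∸m]≡n 2≤k)))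
      colour-triangle-free decompose))
    where
    f : ℕ → ℕ
    f m = m + (k ∸ 2)

    decompose : ∀ X → HasTriangle G X →
      Reducible G X ⊎ (∃ (DoubleTransversal G X) × (∀ m → k + f m ≤ f (2 + m)))
    decompose X t with reducible? G X
    ... | yes red  = inj₁ red
    -- Irreducible sets have no triangles here, so every set with a triangle is reducible.
    ... | no irred = contradiction t
      (HammerFreeStructure.triangle-free G square-free (hammer-free G H≅ H-free) X irred)

theorem1p4 : {ℓ : Level} (H : Graph) → (H ≅ bull) ⊎ (H ≅ hammer) →
    (k : ℕ) → 2 ≤ k →
    (𝓕 : Pred Graph ℓ) → Hereditary 𝓕 →
    (∀ F → F ∈ 𝓕 → ω F ≤ 2 → χ F ≤ k) →
    ∀ G → G ∈ Free (C₄ ∷ H ∷ []) ∩ 𝓕 →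
    (H ≅ bull → 2 * χ G ≤ k * ω G) × (H ≅ hammer → χ G ≤ (ω G + k) ∸ 2)
theorem1p4 H _ k 2≤k 𝓕 hereditary bound G (C₄-free ∷ H-free ∷ [] , G∈) =
  bull-bound H k 2≤k 𝓕 hereditary bound G C₄-free H-free G∈ ,
  hammer-bound H k 2≤k 𝓕 hereditary bound G C₄-free H-free G∈
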